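{- The parameterized problem $p\textit{ -deg- }\textsc{Independent-Set}$ is slicewise definable in $\mathrm{FO}_{13}$.
   Context: Let $\tau_{\textsc{Graph}}=\{E,<,+,\times\}$ with $E$ binary. For $n\in\mathbb N$ let $[n]:=\{0,\dots,n-1\}$ with natural order and $+^{[n]}=\{(a,b,c)\in[n]^3:c=a+b\}$, $\times^{[n]}=\{(a,b,c)\in[n]^3:c=ab\}$. A finite $\tau$-structure has built-in addition and multiplication if its $\{<,+,\times\}$-reduct is isomorphic to $([n],<^{[n]},+^{[n]},\times^{[n]})$; $\mathrm{ARITHM}[\tau]$ is the class of these. $C(m)=\{\overline\ell:\ell<m\}$ are new constants, and $\mathbf A_{C(m)}$ interprets $\overline\ell$ as the element corresponding to $\ell$ if $\ell<|A|$, else to $|A|-1$. $\mathrm{FO}_q$ is the set of first-order sentences of quantifier rank at most $q$. A parameterized problem $Q\subseteq\mathrm{ARITHM}[\tau]\times\mathbb N$ (slices closed under isomorphism) is slicewise definable in $\mathrm{FO}_q$ if there are computable $h$ and $f$ with $f(k)$ an $\mathrm{FO}_q[\tau\cup C(h(k))]$-sentence such that $(\mathbf A,k)\in Q\iff\mathbf A_{C(h(k))}\models f(k)$ for all $(\mathbf A,k)$. For a graph $\mathbf G$, $\deg(\mathbf G)$ is its maximum vertex degree. $p\textit{ -deg- }\textsc{Independent-Set}$ is the class of pairs $(\mathbf G,k)\in\mathrm{ARITHM}[\tau_{\textsc{Graph}}]\times\mathbb N$ such that the $\{E\}$-reduct of $\mathbf G$ is a graph, $k\ge\deg(\mathbf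 G)$, and this graph has an independent set of $k-\deg(\mathbf G)$ elements. -}

module Defs where

open import Data.Nat using (ℕ; zero; suc; _+_; _*_; _∸_; _≤_; _⊔_; _<ᵇ_; _≡ᵇ_)
open import Data.Fin using (Fin; toℕ)
import Data.Fin as F
open import Data.List using (List; map; foldr; allFin)
open import Data.Nat.ListAction using (sum)
open import Data.Bool using (Bool; true; false; if_then_else_)
open import Data.Product using (Σ; _×_; _,_)
open import Data.Sum using (_⊎_)
open import Data.Empty using (⊥)
open import Relation.Binary.PropositionalEquality using (_≡_)

-- Finite τ_Graph-structures, τ_Graph = {E, <, +, ×}
-- (relations are Boolean-valued: finite structures, decidable relations)

record GStr : Set₁ where
  field
    U   : Set
    E   : U → U → Bool
    Lt  : U → U → Bool
    Add : U → U → U → Bool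
    Mul : U → U → U → Bool

open GStr public

-- A witness that the {<,+,×}-reduct of A is isomorphic to
-- ([n], <, +, ×) with n = suc m  (structures are nonempty).
record Arithm (A : GStr) : Set where
  field
    m     : ℕ
    ι     : Fin (suc m) → U A
    ι-inj : ∀ a b → ι a ≡ ι b → a ≡ b
    ι-sur : ∀ u → Σ (Fin (suc m)) (λ a → ι a ≡ u)
    ι-lt  : ∀ a b → Lt A (ι a) (ι b) ≡ (toℕ a <ᵇ toℕ b)
    ι-add : ∀ a b c → Add A (ι a) (ι b) (ι c) ≡ (toℕ a + toℕ b ≡ᵇ toℕ c)
    ι-mul : ∀ a b c → Mul A (ι a) (ι b) (ι c) ≡ (toℕ a * toℕ b ≡ᵇ toℕ c)

open Arithm public

-- First-order logic over τ_Graph ∪ C(c): c constants, v free variables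
-- (de Bruijn), equality included.

data Term (c v : ℕ) : Set where
  var : Fin v → Term c v
  cst : Fin c → Term c v

data Formula (c : ℕ) : ℕ → Set where
  E'   : ∀ {v} → Term c v → Term c v → Formula c v
  Lt'  : ∀ {v} → Term c v → Term c v → Formula c v
  Add' : ∀ {v} → Term c v → Term c v → Term c v → Formula c v
  Mul' : ∀ {v} → Term c v → Term c v → Term c v → Formula c v
  _≐_  : ∀ {v} → Term c v → Term c v → Formula c v
  ¬'_  : ∀ {v} → Formula c v → Formula c v
  _∧'_ : ∀ {v} → Formula c v → Formula c v → Formula c v
  _∨'_ : ∀ {v} → Formula c v → Formula c v → Formula c v
  ∃'_  : ∀ {v} → Formula c (suc v) → Formula c v
  ∀'_  : ∀ {v} → Formula c (suc v) → Formula c v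

Sentence : ℕ → Set
Sentence c = Formula c 0

qr : ∀ {c v} → Formula c v → ℕ
qr (E' _ _)     = 0
qr (Lt' _ _)    = 0
qr (Add' _ _ _) = 0
qr (Mul' _ _ _) = 0
qr (_ ≐ _)      = 0
qr (¬' φ)       = qr φ
qr (φ ∧' ψ)     = qr φ ⊔ qr ψ
qr (φ ∨' ψ)     = qr φ ⊔ qr ψ
qr (∃' φ)       = suc (qr φ)
qr (∀' φ)       = suc (qr φ)

FO : ℕ → ℕ → Set
FO q c = Σ (Sentence c) (λ φ → qr φ ≤ q)

extend : ∀ {X : Set} {v} → X → (Fin v → X) → Fin (suc v) → X
extend x ρ F.zero    = x
extend x ρ (F.suc i) = ρ i

clamp : (m ℓ : ℕ) → Fin (suc m)
clamp zero    _       = F.zero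
clamp (suc m) zero    = F.zero
clamp (suc m) (suc ℓ) = F.suc (clamp m ℓ)

-- interpretation of constant ℓ in A_{C(c)}: the element corresponding to
-- ℓ if ℓ < |A|, else to |A| - 1
constInterp : (A : GStr) → Arithm A → ℕ → U A
constInterp A ar ℓ = ι ar (clamp (m ar) ℓ)

module _ (A : GStr) (ar : Arithm A) where

  evalT : ∀ {c v} → (Fin v → U A) → Term c v → U A
  evalT ρ (var i) = ρ i
  evalT ρ (cst ℓ) = constInterp A ar (toℕ ℓ)

  Sat : ∀ {c v} → (Fin v → U A) → Formula c v → Set
  Sat ρ (E' s t)       = E A (evalT ρ s) (evalT ρ t) ≡ true
  Sat ρ (Lt' s t)      = Lt A (evalT ρ s) (evalT ρ t) ≡ true
  Sat ρ (Add' s t r)   = Add A (evalT ρ s) (evalT ρ t) (evalT ρ r) ≡ true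
  Sat ρ (Mul' s t r)   = Mul A (evalT ρ s) (evalT ρ t) (evalT ρ r) ≡ true
  Sat ρ (s ≐ t)        = evalT ρ s ≡ evalT ρ t
  Sat ρ (¬' φ)         = Sat ρ φ → ⊥
  Sat ρ (φ ∧' ψ)       = Sat ρ φ × Sat ρ ψ
  Sat ρ (φ ∨' ψ)       = Sat ρ φ ⊎ Sat ρ ψ
  Sat ρ (∃' φ)         = Σ (U A) (λ x → Sat (extend x ρ) φ)
  Sat ρ (∀' φ)         = (x : U A) → Sat (extend x ρ) φ

  Models : ∀ {c} → Sentence c → Set
  Models φ = Sat (λ ()) φ

IsGraph : GStr → Set
IsGraph A = (∀ u → E A u u ≡ false) × (∀ u w → E A u w ≡ E A w u)

module _ (A : GStr) (ar : Arithm A) where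

  vdeg : U A → ℕ
  vdeg u = sum (map (λ i → if E A u (ι ar i) then 1 else 0) (allFin (suc (m ar))))

  maxDeg : ℕ
  maxDeg = foldr _⊔_ 0 (map (λ i → vdeg (ι ar i)) (allFin (suc (m ar))))

HasIndepSet : GStr → ℕ → Set
HasIndepSet A s =
  Σ (Fin s → U A) λ g →
    (∀ i j → g i ≡ g j → i ≡ j) × (∀ i j → E A (g i) (g j) ≡ false)

pDegIndSet : (A : GStr) → Arithm A → ℕ → Set
pDegIndSet A ar k =
  IsGraph A × (maxDeg A ar ≤ k) × HasIndepSet A (k ∸ maxDeg A ar)

-- slicewise definability in FO_q (h, f are Agda functions, hence computable)

SlicewiseDefinable : ℕ → ((A : GStr) → Arithm A → ℕ → Set) → Set₁
SlicewiseDefinable q Q =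
  Σ (ℕ → ℕ) λ h →
  Σ ((k : ℕ) → FO q (h k)) λ f →
    (A : GStr) (ar : Arithm A) (k : ℕ) →
      (Q A ar k → Models A ar (Σ.proj₁ (f k))) × (Models A ar (Σ.proj₁ (f k)) → Q A ar k)

{-# OPTIONS --safe #-}
module Submission where

-- Every greedy choice of a vertex in a graph of maximum degree at most k blocks at most k + 1
-- vertices, so a graph with more than k (k + 1) vertices and degree at most k always has an
-- independent set of size k.  Below a threshold depending on k, all elements are named by
-- constants and the whole problem is expressed without counting.  Above it, only "degree at most k"
-- remains to be expressed with a quantifier rank independent of k.  For this, "u has s neighbours"
-- is written as: there are w, b and s moduli of Gödel's form 1 + c b (c a constant) such that each
-- modulus has a neighbour of u congruent to w modulo it, but modulo none of the other ones.
-- Such neighbours are automatically distinct.  Conversely, given s neighbours, the product of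
-- their differences is less than a power of b that depends only on s, so among sufficiently many
-- windows of s pairwise coprime moduli there is one none of whose members divides a difference, and
-- the Chinese remainder theorem for that window yields w.

open import Defs
open import Data.Nat using (ℕ; zero; suc; _+_; _*_; _∸_; _^_; _⊔_; _⊓_; _!; _≤_; _<_;
  _≤?_; _<?_; _≡ᵇ_; ∣_-_∣; z≤n; s≤s; s≤s⁻¹; NonZero; >-nonZero)
open import Data.Nat.Properties using (*-assoc; *-comm; *-distribʳ-∣-∣; *-identityʳ; *-mono-≤;
  *-monoʳ-≤; *-monoˡ-≤; *-suc; +-comm; +-identityʳ; +-mono-≤; +-monoˡ-<; +-suc; 1+n≢n; 1≤n!;
  <-cmp; <-irrefl; <-≤-trans; <⇒≤; <⇒≱; ^-*-assoc; ^-monoʳ-<; ^-monoˡ-≤; ^-zeroˡ; m+[n∸m]≡n;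
  m<m+n; m^n>0; m^n≢0; m∸n≡0⇒m≤n; m∸n≤m; m≤m*n; m≤m+n; m≤n*m; m≤n+m; m≤n⇒m≤1+n; m≤n⇒m⊓n≡m;
  m≤n⇒m⊔n≡n; m≤n⇒∣m-n∣≡n∸m; m≥n⇒m⊓n≡n; m≥n⇒m⊔n≡m; n≢0⇒n>0; n≤1+n; ∣-∣-comm; ∣m+n-m+o∣≡∣n-o∣;
  ∣m-n∣≡0⇒m≡n; ∣m-n∣≤m⊔n; ∸-monoʳ-≤; ≡ᵇ⇒≡; ≡⇒≡ᵇ; ≤-refl; ≤-reflexive; ≤-total; ≤-trans; ≮⇒≥;
  ≰⇒>; ⊔-lub; m≤m⊔n; m≤n⊔m; suc-injective; module ≤-Reasoning)
open import Data.Nat.Divisibility using (*-monoʳ-∣; 1∣_; _∣?_; _∣_; divides; m∣m*n; m≤n⇒m!∣n!;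
  ∣-trans; ∣1⇒≡1; ∣m+n∣m⇒∣n; ∣m⇒∣m*n; ∣n⇒∣m*n; ∣⇒≤)
open import Data.Nat.DivMod using (_/_; _%_; m≡m%n+[m/n]*n; m%n<n)
open import Data.Nat.Coprimality using (Coprime; coprime-divisor; coprime-Bézout)
  renaming (sym to coprime-sym)
open import Data.Nat.GCD using (module Bézout)
open import Data.Nat.ListAction using (sum)
open import Data.Nat.Tactic.RingSolver using (solve-∀)
open import Data.Fin using (Fin; toℕ; combine; finToFun; funToFin; inject≤)
  renaming (zero to fz; suc to fs; _≟_ to _≟ᶠ_)
open import Data.Fin.Properties using (toℕ<n; toℕ-injective; combine-injective; any?; all?; ¬∀⟶∃¬;
  injective⇒≤; finToFun-funToFin; inject≤-injective) renaming (suc-injective to fs-injective)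
open import Data.Bool using (Bool; true; false; if_then_else_) renaming (_≟_ to _≟ᵇ_)
open import Data.Bool.Properties using (T-≡; ¬-not; not-¬)
open import Data.List using (List; []; _∷_; _++_; map; foldr; allFin; filter; length; lookup)
open import Data.List.Properties using (length-++)
open import Data.List.Membership.Propositional using (_∈_)
open import Data.List.Membership.Propositional.Properties using (∈-filter⁺; ∈-filter⁻; ∈-allFin;
  ∈-lookup; ∈-map⁺; ∈-map⁻; ∈-++⁺ˡ; ∈-++⁺ʳ)
import Data.List.Membership.DecPropositional as DecMembership
open import Data.List.Relation.Unary.Any as Any using (here; there)
open import Data.List.Relation.Unary.Any.Properties using (lookup-index)
open import Data.List.Relation.Unary.All as All using ()
open import Data.List.Relation.Unary.AllPairs using (_∷_)
open import Data.List.Relation.Unary.Unique.Propositional using (Unique)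
open import Data.List.Relation.Unary.Unique.Propositional.Properties using (filter⁺; allFin⁺)
open import Data.Product using (Σ; _×_; _,_; proj₁; proj₂)
open import Data.Sum using (_⊎_; inj₁; inj₂)
open import Data.Empty using (⊥; ⊥-elim)
open import Function using (_∘_; Equivalence)
open import Relation.Nullary using (¬_; Dec; yes; no; ¬?)
open import Relation.Nullary.Decidable using (decidable-stable)
open import Relation.Binary.Definitions using (tri<; tri≈; tri>)
open import Relation.Binary.PropositionalEquality using (_≡_; _≢_; refl; sym; trans; cong; cong₂;
  subst; subst₂; module ≡-Reasoning)

-- Congruences and coprime moduli

Π : ∀ {n} → (Fin n → ℕ) → ℕ
Π {zero}  f = 1
Π {suc n} f = f fz * Π (f ∘ fs)

Π-≤-^ : ∀ {n} (f : Fin n → ℕ) b → (∀ i → f i ≤ b) → Π f ≤ b ^ n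
Π-≤-^ {zero}  f b f≤b = ≤-refl
Π-≤-^ {suc n} f b f≤b = *-mono-≤ (f≤b fz) (Π-≤-^ (f ∘ fs) b (f≤b ∘ fs))

^-≤-Π : ∀ {n} (f : Fin n → ℕ) b → (∀ i → b ≤ f i) → b ^ n ≤ Π f
^-≤-Π {zero}  f b b≤f = ≤-refl
^-≤-Π {suc n} f b b≤f = *-mono-≤ (b≤f fz) (^-≤-Π (f ∘ fs) b (b≤f ∘ fs))

1≤Π : ∀ {n} (f : Fin n → ℕ) → (∀ i → 1 ≤ f i) → 1 ≤ Π f
1≤Π {n} f 1≤f = ≤-trans (≤-reflexive (sym (^-zeroˡ n))) (^-≤-Π f 1 1≤f)

∣Π : ∀ {n} (f : Fin n → ℕ) i → f i ∣ Π f
∣Π f fz     = m∣m*n _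
∣Π f (fs i) = ∣n⇒∣m*n (f fz) (∣Π (f ∘ fs) i)

PairwiseCoprime : ∀ {n} → (Fin n → ℕ) → Set
PairwiseCoprime f = ∀ i j → i ≢ j → Coprime (f i) (f j)

coprime-* : ∀ {a b c} → Coprime a b → Coprime a c → Coprime a (b * c)
coprime-* a⊥b a⊥c (d∣a , d∣bc) =
  a⊥c (d∣a , coprime-divisor (λ (e∣d , e∣b) → a⊥b (∣-trans e∣d d∣a , e∣b)) d∣bc)

coprime-Π : ∀ {n a} (f : Fin n → ℕ) → (∀ i → Coprime a (f i)) → Coprime a (Π f)
coprime-Π {zero}  f a⊥f (_ , d∣1) = ∣1⇒≡1 d∣1
coprime-Π {suc n} f a⊥f = coprime-* (a⊥f fz) (coprime-Π (f ∘ fs) (a⊥f ∘ fs))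

pairwise-head : ∀ {n} {f : Fin (suc n) → ℕ} → PairwiseCoprime f → Coprime (f fz) (Π (f ∘ fs))
pairwise-head {f = f} cop = coprime-Π (f ∘ fs) (λ i → cop fz (fs i) λ ())

pairwise-tail : ∀ {n} {f : Fin (suc n) → ℕ} → PairwiseCoprime f → PairwiseCoprime (f ∘ fs)
pairwise-tail cop i j i≢j = cop (fs i) (fs j) (i≢j ∘ fs-injective)

-- Write `d` as `q * f fz`. The product of the other factors divides this and is coprime to `f fz`,
-- so it divides `q`.
Π∣ : ∀ {n d} (f : Fin n → ℕ) → PairwiseCoprime f → (∀ i → f i ∣ d) → Π f ∣ d
Π∣ {zero}          f cop f∣d = 1∣ _
Π∣ {suc n} {d} f cop f∣d with f∣d fz
... | divides q refl = subst (f fz * Π (f ∘ fs) ∣_) (*-comm (f fz) q) (*-monoʳ-∣ (f fz)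
      (coprime-divisor (coprime-sym (pairwise-head {f = f} cop))
        (subst (Π (f ∘ fs) ∣_) (*-comm q (f fz)) (Π∣ (f ∘ fs) (pairwise-tail cop) (f∣d ∘ fs)))))

-- Congruence with both sides moved so that no subtraction occurs.
infix 4 _≋_[mod_]
_≋_[mod_] : ℕ → ℕ → ℕ → Set
u ≋ v [mod m ] = Σ ℕ λ p → Σ ℕ λ q → u + p * m ≡ v + q * m

≋-sym : ∀ {m u v} → u ≋ v [mod m ] → v ≋ u [mod m ]
≋-sym (p , q , eq) = q , p , sym eq

≋-trans : ∀ {m u v w} → u ≋ v [mod m ] → v ≋ w [mod m ] → u ≋ w [mod m ]
≋-trans {m} {u} {v} {w} (p , q , eq) (p′ , q′ , eq′) = p + p′ , q + q′ , (begin
  u + (p + p′) * m        ≡⟨ regroup u p p′ m ⟩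
  (u + p * m) + p′ * m    ≡⟨ cong (_+ p′ * m) eq ⟩
  (v + q * m) + p′ * m    ≡⟨ swap v q p′ m ⟩
  (v + p′ * m) + q * m    ≡⟨ cong (_+ q * m) eq′ ⟩
  (w + q′ * m) + q * m    ≡⟨ regroup′ w q q′ m ⟩
  w + (q + q′) * m        ∎)
  where
  open ≡-Reasoning
  regroup : ∀ u p p′ m → u + (p + p′) * m ≡ (u + p * m) + p′ * m
  regroup = solve-∀
  swap : ∀ v q p′ m → (v + q * m) + p′ * m ≡ (v + p′ * m) + q * m
  swap = solve-∀
  regroup′ : ∀ w q q′ m → (w + q′ * m) + q * m ≡ w + (q + q′) * m
  regroup′ = solve-∀

≋⇒∣ : ∀ {m u v} → u ≋ v [mod m ] → m ∣ ∣ u - v ∣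
≋⇒∣ {m} {u} {v} (p , q , eq) = divides ∣ q - p ∣ (begin
  ∣ u - v ∣                            ≡⟨ ∣m+n-m+o∣≡∣n-o∣ (p * m) u v ⟨
  ∣ p * m + u - p * m + v ∣            ≡⟨ cong (λ z → ∣ z - p * m + v ∣) (trans (+-comm (p * m) u) eq) ⟩
  ∣ v + q * m - p * m + v ∣            ≡⟨ cong (∣ v + q * m -_∣) (+-comm (p * m) v) ⟩
  ∣ v + q * m - v + p * m ∣            ≡⟨ ∣m+n-m+o∣≡∣n-o∣ v (q * m) (p * m) ⟩
  ∣ q * m - p * m ∣                    ≡⟨ *-distribʳ-∣-∣ m q p ⟨
  ∣ q - p ∣ * m                        ∎)
  where open ≡-Reasoning

-- Here `m * q` is at most the larger of `u` and `v`, so a finite universe containing both has room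
-- for it. The formula `congruent` uses this form.
≋⇒multiple : ∀ {m u v} → u ≋ v [mod m ] →
             Σ ℕ λ q → (u + m * q ≡ v) ⊎ (v + m * q ≡ u)
≋⇒multiple {m} {u} {v} u≋v with ≋⇒∣ u≋v | ≤-total u v
... | divides q eq | inj₁ u≤v = q , inj₁ (trans (cong (u +_) m*q≡) (m+[n∸m]≡n u≤v))
  where
  m*q≡ : m * q ≡ v ∸ u
  m*q≡ = trans (*-comm m q) (trans (sym eq) (m≤n⇒∣m-n∣≡n∸m u≤v))
... | divides q eq | inj₂ v≤u = q , inj₂ (trans (cong (v +_) m*q≡) (m+[n∸m]≡n v≤u))
  where
  m*q≡ : m * q ≡ u ∸ v
  m*q≡ = trans (*-comm m q) (trans (sym eq) (trans (∣-∣-comm u v) (m≤n⇒∣m-n∣≡n∸m v≤u)))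

multiple⇒≋ : ∀ {m u v q} → (u + m * q ≡ v) ⊎ (v + m * q ≡ u) → u ≋ v [mod m ]
multiple⇒≋ {m} {u} {v} {q} (inj₁ eq) = q , 0 ,
  trans (cong (u +_) (*-comm q m)) (trans eq (sym (+-identityʳ v)))
multiple⇒≋ {m} {u} {v} {q} (inj₂ eq) = 0 , q ,
  trans (+-identityʳ u) (trans (sym eq) (cong (v +_) (*-comm m q)))

inverse : ∀ {a m} .{{_ : NonZero m}} → Coprime a m → Σ ℕ λ e → a * e ≋ 1 [mod m ]
inverse {a} {m} a⊥m with coprime-Bézout a⊥m
... | Bézout.+- x y eq = x , 0 , y , trans (+-identityʳ (a * x)) (trans (*-comm a x) (sym eq))
-- Now `1 + x * a ≡ y * m`, so minus `x` inverts `a`. It is represented by `x * m′`, as `m′` is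
-- congruent to minus 1.
inverse {a} {m@(suc m′)} a⊥m | Bézout.-+ x y eq = x * m′ , 1 , y * m′ , (begin
  a * (x * m′) + 1 * suc m′   ≡⟨ expand a x m′ ⟩
  1 + (1 + x * a) * m′        ≡⟨ cong (λ z → 1 + z * m′) eq ⟩
  1 + (y * suc m′) * m′       ≡⟨ reorder y m′ ⟩
  1 + (y * m′) * suc m′       ∎)
  where
  open ≡-Reasoning
  expand : ∀ a x m′ → a * (x * m′) + 1 * suc m′ ≡ 1 + (1 + x * a) * m′
  expand = solve-∀
  reorder : ∀ y m′ → 1 + (y * suc m′) * m′ ≡ 1 + (y * m′) * suc m′
  reorder = solve-∀

linear-congruence : ∀ {a m} .{{_ : NonZero m}} → Coprime a m → ∀ c x →
                    Σ ℕ λ q → q < m × c + a * q ≋ x [mod m ]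
linear-congruence {a} {m@(suc m′)} a⊥m c x with inverse a⊥m
... | e , p , r , eq = q₀ % m , m%n<n q₀ m , a * (q₀ / m) + p * z , c + r * z , (begin
  c + a * (q₀ % m) + (a * (q₀ / m) + p * z) * m    ≡⟨ collect c a (q₀ % m) (q₀ / m) p z m ⟩
  c + (a * (q₀ % m + q₀ / m * m) + p * m * z)      ≡⟨ cong (λ y → c + (a * y + p * m * z)) (m≡m%n+[m/n]*n q₀ m) ⟨
  c + (a * (e * z) + p * m * z)                    ≡⟨ factor c a e z p m ⟩
  c + (a * e + p * m) * z                          ≡⟨ cong (λ y → c + y * z) eq ⟩
  c + (1 + r * m) * z                              ≡⟨ finish c r m′ x ⟩
  x + (c + r * z) * m                              ∎)
  where
  open ≡-Reasoning
  -- Modulo `m`, `z` stands for `x - c`. Multiplying it by the inverse `e` and reducing yields a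
  -- solution below `m`.
  z q₀ : ℕ
  z  = x + m′ * c
  q₀ = e * z
  collect : ∀ c a u v p z m → c + a * u + (a * v + p * z) * m ≡ c + (a * (u + v * m) + p * m * z)
  collect = solve-∀
  factor : ∀ c a e z p m → c + (a * (e * z) + p * m * z) ≡ c + (a * e + p * m) * z
  factor = solve-∀
  finish : ∀ c r m′ x → c + (1 + r * suc m′) * (x + m′ * c) ≡ x + (c + r * (x + m′ * c)) * suc m′
  finish = solve-∀

-- A solution for the tail stays one after adding multiples of the tail product `P`. As `P` is
-- coprime to the first modulus, some multiple `P * q` with `q < μ fz` also settles the first
-- congruence, and this bound on `q` keeps the sum below `Π μ`.
chinese-remainder : ∀ {n} (μ : Fin n → ℕ) → (∀ i → NonZero (μ i)) → PairwiseCoprime μ →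
                    (x : Fin n → ℕ) → Σ ℕ λ w → w < Π μ × (∀ i → w ≋ x i [mod μ i ])
chinese-remainder {zero}  μ nz cop x = 0 , s≤s z≤n , λ ()
chinese-remainder {suc n} μ nz cop x
  with chinese-remainder (μ ∘ fs) (nz ∘ fs) (pairwise-tail cop) (x ∘ fs)
... | w , w<P , w≋x
  with linear-congruence {{nz fz}} (coprime-sym (pairwise-head {f = μ} cop)) w (x fz)
... | q , q<μ₀ , eq = w + P * q , bound , λ where
        fz     → eq
        (fs i) → ≋-trans (step i) (w≋x i)
  where
  P = Π (μ ∘ fs)
  bound : w + P * q < μ fz * P
  bound = begin-strict
    w + P * q   <⟨ +-monoˡ-< (P * q) w<P ⟩
    P + P * q   ≡⟨ *-suc P q ⟨
    P * suc q   ≤⟨ *-monoʳ-≤ P q<μ₀ ⟩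
    P * μ fz    ≡⟨ *-comm P (μ fz) ⟩
    μ fz * P    ∎
    where open ≤-Reasoning
  step : ∀ i → w + P * q ≋ w [mod μ (fs i) ]
  step i with ∣m⇒∣m*n q (∣Π (μ ∘ fs) i)
  ... | divides r Pq≡ = 0 , r , trans (+-identityʳ _) (cong (w +_) Pq≡)

-- A common divisor divides `c′ * (1 + c * b) - c * (1 + c′ * b)`, which is `c′ - c`. This lies
-- between 1 and `L`, so the divisor divides `L !`, hence `b`, hence 1.
gödel-coprime : ∀ {L b c c′} → 1 ≤ c → c < c′ → c′ ≤ L → L ! ∣ b →
                Coprime (1 + c * b) (1 + c′ * b)
gödel-coprime {L} {b} {c} {c′} 1≤c c<c′ c′≤L L!∣b {d} (d∣ , d∣′) =
  ∣1⇒≡1 (∣m+n∣m⇒∣n (subst (d ∣_) (+-comm 1 (c * b)) d∣) (∣n⇒∣m*n c d∣b))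
  where
  δ = c′ ∸ c
  c′≡ : c′ ≡ c + δ
  c′≡ = sym (m+[n∸m]≡n (<⇒≤ c<c′))
  identity : ∀ c δ b → (c + δ) * (1 + c * b) ≡ c * (1 + (c + δ) * b) + δ
  identity = solve-∀
  d∣δ : d ∣ δ
  d∣δ = ∣m+n∣m⇒∣n
    (subst (d ∣_) (identity c δ b) (∣n⇒∣m*n (c + δ) d∣))
    (∣n⇒∣m*n c (subst (λ z → d ∣ 1 + z * b) c′≡ d∣′))
  δ∣L! : δ ∣ L !
  δ∣L! with δ in δ-eq
  ... | zero   = ⊥-elim (<-irrefl refl (<-≤-trans c<c′ (m∸n≡0⇒m≤n δ-eq)))
  ... | suc δ′ = ∣-trans (m∣m*n (δ′ !))
    (m≤n⇒m!∣n! (≤-trans (≤-reflexive (sym δ-eq)) (≤-trans (m∸n≤m c′ c) c′≤L)))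
  d∣b : d ∣ b
  d∣b = ∣-trans d∣δ (∣-trans δ∣L! L!∣b)

-- An upward search from `c` with at most `r` steps; at `r = 0` the two bounds contradict each
-- other.
threshold-crossing : ∀ (f : ℕ → ℕ) (c n r : ℕ) → f c ≤ n → n < f (r + c) →
                     Σ ℕ λ t → c ≤ t × f t ≤ n × n < f (suc t)
threshold-crossing f c n zero    fc≤n n<f = ⊥-elim (<-irrefl refl (<-≤-trans n<f fc≤n))
threshold-crossing f c n (suc r) fc≤n n<f with f (suc c) ≤? n
... | no  f>n = c , ≤-refl , fc≤n , ≰⇒> f>n
... | yes f≤n with threshold-crossing f (suc c) n r f≤n (subst (λ z → n < f z) (sym (+-suc r c)) n<f)
...   | t , c<t , rest = t , <⇒≤ c<t , rest

-- Windows of Gödel moduli separating given numbers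

module Separation (d : ℕ) where

  s : ℕ
  s = suc d

  -- M < (t + 1) ^ (2 s) for the t chosen below, and Δ is a product of s ^ 2 numbers at most M.
  opaque
    N : ℕ
    N = suc ((2 * s) * (s * s))

    N> : (2 * s) * (s * s) < N
    N> = ≤-refl

  -- `L` is the number of coefficients in all windows. For `b = L ! * t` with `t ≥ 1` every modulus
  -- is at most `C * t`. `θ` is `(C * t) ^ s` at `t = C`, where the search for `t` starts.
  L C θ : ℕ
  L = N * s
  C = 1 + L * L !
  θ = (C * C) ^ s

  m≤m^[1+d] : ∀ m → 1 ≤ m → m ≤ m ^ s
  m≤m^[1+d] m 1≤m = m≤m*n m (m ^ d) {{m^n≢0 m d {{>-nonZero 1≤m}}}}

  -- The window o consists of the moduli 1 + c b with o s < c ≤ (o + 1) s.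
  index : Fin N → Fin s → ℕ
  index o j = suc (toℕ (combine o j))

  modulus : ℕ → Fin N → Fin s → ℕ
  modulus b o j = 1 + index o j * b

  index≤L : ∀ o j → index o j ≤ L
  index≤L o j = toℕ<n (combine o j)

  L≤θ : L ≤ θ
  L≤θ = begin
    L              ≤⟨ m≤m*n L (L !) {{>-nonZero (1≤n! L)}} ⟩
    L * L !        ≤⟨ n≤1+n _ ⟩
    C              ≤⟨ m≤m*n C C ⟩
    C * C          ≤⟨ m≤m^[1+d] (C * C) (s≤s z≤n) ⟩
    θ              ∎
    where open ≤-Reasoning

  modulus-coprime : ∀ {b} → L ! ∣ b → ∀ o j o′ j′ → ¬ (o ≡ o′ × j ≡ j′) →
                    Coprime (modulus b o j) (modulus b o′ j′)
  modulus-coprime L!∣b o j o′ j′ ne with <-cmp (index o j) (index o′ j′)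
  ... | tri< lt _ _ = gödel-coprime (s≤s z≤n) lt (index≤L o′ j′) L!∣b
  ... | tri≈ _ eq _ = ⊥-elim (ne (combine-injective o j o′ j′ (toℕ-injective (suc-injective eq))))
  ... | tri> _ _ gt = coprime-sym (gödel-coprime (s≤s z≤n) gt (index≤L o j) L!∣b)

  Separated : (M : ℕ) → (Fin s → ℕ) → Set
  Separated M x = Σ ℕ λ b → Σ ℕ λ w → Σ (Fin N) λ o →
    w ≤ M × (∀ j → modulus b o j ≤ M) × (∀ j → w ≋ x j [mod modulus b o j ]) ×
    (∀ i j → i ≢ j → ¬ x i ≋ x j [mod modulus b o i ])

  module _ {M : ℕ} (θ≤M : θ ≤ M) (x : Fin s → ℕ)
           (x-inj : ∀ i j → x i ≡ x j → i ≡ j) (x≤M : ∀ i → x i ≤ M) where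

    -- The maximum with 1 discards the vanishing differences δ i i from the product Δ.
    δ : Fin s → Fin s → ℕ
    δ i j = ∣ x i - x j ∣ ⊔ 1

    Δ : ℕ
    Δ = Π λ i → Π λ j → δ i j

    1≤M : 1 ≤ M
    1≤M = ≤-trans (m^n>0 (C * C) s) θ≤M

    Δ≤ : Δ ≤ M ^ (s * s)
    Δ≤ = ≤-trans
      (Π-≤-^ (λ i → Π (δ i)) (M ^ s) λ i → Π-≤-^ (δ i) M λ j →
        ⊔-lub (≤-trans (∣m-n∣≤m⊔n (x i) (x j)) (⊔-lub (x≤M i) (x≤M j))) 1≤M)
      (≤-reflexive (^-*-assoc M s s))

    1≤Δ : 1 ≤ Δ
    1≤Δ = 1≤Π _ λ i → 1≤Π (δ i) λ j → m≤n⊔m ∣ x i - x j ∣ 1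

    -- A congruence would make `m` divide the difference of `x i` and `x j`. That difference is
    -- positive by injectivity, so it equals the factor `δ i j` of `Δ`.
    ∤Δ⇒≋̸ : ∀ {m} → ¬ m ∣ Δ → ∀ i j → i ≢ j → ¬ x i ≋ x j [mod m ]
    ∤Δ⇒≋̸ {m} m∤Δ i j i≢j xi≋xj = m∤Δ
      (∣-trans (subst (m ∣_) (sym (m≥n⇒m⊔n≡m 1≤∣∣)) (≋⇒∣ xi≋xj))
        (∣-trans (∣Π (δ i) j) (∣Π (λ i → Π (δ i)) i)))
      where
      1≤∣∣ : 1 ≤ ∣ x i - x j ∣
      1≤∣∣ = n≢0⇒n>0 λ eq → i≢j (x-inj i j (∣m-n∣≡0⇒m≡n eq))

    -- `lower` gives room for the product of a whole window, and thus for `w`; `upper` bounds `M`,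
    -- and with it `Δ`, by a power of `suc t`.
    module _ (t : ℕ) (C≤t : C ≤ t) (lower : (C * t) ^ s ≤ M) (upper : M < (C * suc t) ^ s) where

      -- The factor `L !` makes the moduli coprime, the factor `t` makes them exceed `t`.
      b : ℕ
      b = L ! * t

      L!∣b : L ! ∣ b
      L!∣b = m∣m*n t

      1≤t : 1 ≤ t
      1≤t = ≤-trans (s≤s z≤n) C≤t

      t<modulus : ∀ o j → suc t ≤ modulus b o j
      t<modulus o j = s≤s (≤-trans (m≤n*m t (L !) {{>-nonZero (1≤n! L)}}) (m≤m+n b _))

      modulus≤ : ∀ o j → modulus b o j ≤ C * t
      modulus≤ o j = +-mono-≤ 1≤t
        (≤-trans (*-monoˡ-≤ b (index≤L o j)) (≤-reflexive (sym (*-assoc L (L !) t))))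

      -- Since `C ≤ t`, the constant `C` is absorbed by one more factor `suc t`, so that the
      -- exponent depends only on `s`.
      Δ< : Δ < suc t ^ N
      Δ< = begin-strict
        Δ                                ≤⟨ Δ≤ ⟩
        M ^ (s * s)                      ≤⟨ ^-monoˡ-≤ (s * s) (<⇒≤ upper) ⟩
        ((C * suc t) ^ s) ^ (s * s)      ≤⟨ ^-monoˡ-≤ (s * s) (^-monoˡ-≤ s C*T≤T²) ⟩
        ((suc t ^ 2) ^ s) ^ (s * s)      ≡⟨ cong (_^ (s * s)) (^-*-assoc (suc t) 2 s) ⟩
        (suc t ^ (2 * s)) ^ (s * s)      ≡⟨ ^-*-assoc (suc t) (2 * s) (s * s) ⟩
        suc t ^ ((2 * s) * (s * s))      <⟨ ^-monoʳ-< (suc t) (s≤s 1≤t) N> ⟩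
        suc t ^ N                        ∎
        where
        open ≤-Reasoning
        C*T≤T² : C * suc t ≤ suc t ^ 2
        C*T≤T² = *-mono-≤ (m≤n⇒m≤1+n C≤t) (≤-reflexive (sym (*-identityʳ (suc t))))

      good? : ∀ o → Dec (∀ j → ¬ modulus b o j ∣ Δ)
      good? o = all? λ j → ¬? (modulus b o j ∣? Δ)

      -- If every window had a bad modulus, the product of these N coprime numbers,
      -- all greater than t, would divide Δ < (t + 1) ^ N.
      good-window : Σ (Fin N) λ o → ∀ j → ¬ modulus b o j ∣ Δ
      good-window with any? good?
      ... | yes good = good
      ... | no none = ⊥-elim (<-irrefl refl (begin-strict
        Δ          <⟨ Δ< ⟩
        suc t ^ N  ≤⟨ ^-≤-Π bad (suc t) (λ o → t<modulus o (proj₁ (pick o))) ⟩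
        Π bad      ≤⟨ ∣⇒≤ {{>-nonZero 1≤Δ}} (Π∣ bad bad-coprime (proj₂ ∘ pick)) ⟩
        Δ          ∎))
        where
        open ≤-Reasoning
        pick : ∀ o → Σ (Fin s) λ j → modulus b o j ∣ Δ
        pick o with ¬∀⟶∃¬ s _ (λ j → ¬? (modulus b o j ∣? Δ)) (λ good → none (o , good))
        ... | j , ¬¬∣ = j , decidable-stable (modulus b o j ∣? Δ) ¬¬∣
        bad : Fin N → ℕ
        bad o = modulus b o (proj₁ (pick o))
        bad-coprime : PairwiseCoprime bad
        bad-coprime o o′ o≢o′ = modulus-coprime L!∣b o _ o′ _ (o≢o′ ∘ proj₁)

      separated-at : Separated M x
      separated-at =
        let o , good = good-window
            w , w<Π , w≋x = chinese-remainder (modulus b o) (λ _ → _)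
              (λ i j i≢j → modulus-coprime L!∣b o i o j (i≢j ∘ proj₂)) x
        in b , w , o
        , ≤-trans (<⇒≤ w<Π) (≤-trans (Π-≤-^ (modulus b o) (C * t) (modulus≤ o)) lower)
        , (λ j → ≤-trans (modulus≤ o j)
            (≤-trans (m≤m^[1+d] (C * t) (*-mono-≤ {1} {C} (s≤s z≤n) 1≤t)) lower))
        , w≋x
        , (λ i j i≢j → ∤Δ⇒≋̸ (good i) i j i≢j)

    separated : Separated M x
    separated =
      -- `θ≤M` is the lower bound at `t = C`, and after `M` steps the power exceeds `M` by `large`.
      let t , C≤t , lower , upper = threshold-crossing (λ t → (C * t) ^ s) C M M θ≤M large
      in separated-at t C≤t lower upper
      where
      large : M < (C * (M + C)) ^ s
      large = begin-strict
        M                    <⟨ m<m+n M (s≤s z≤n) ⟩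
        M + C                ≤⟨ m≤n*m (M + C) C ⟩
        C * (M + C)          ≤⟨ m≤m^[1+d] (C * (M + C)) (*-mono-≤ {1} {C} (s≤s z≤n) 1≤M+C) ⟩
        (C * (M + C)) ^ s    ∎
        where
        open ≤-Reasoning
        1≤M+C : 1 ≤ M + C
        1≤M+C = ≤-trans 1≤M (m≤m+n M C)

-- Finite counting

injection-into-list : ∀ {X : Set} {n} (xs : List X) (g : Fin n → X) →
                      (∀ i j → g i ≡ g j → i ≡ j) → (∀ i → g i ∈ xs) → n ≤ length xs
injection-into-list xs g g-inj g∈xs = injective⇒≤ {f = λ i → Any.index (g∈xs i)} λ {i} {j} eq →
  g-inj i j (trans (lookup-index (g∈xs i)) (trans (cong (lookup xs) eq) (sym (lookup-index (g∈xs j)))))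

lookup-injective : ∀ {X : Set} {xs : List X} → Unique xs → ∀ i j → lookup xs i ≡ lookup xs j → i ≡ j
lookup-injective (_ ∷ _)   fz     fz     _  = refl
lookup-injective (x∉ ∷ _)  fz     (fs j) eq = ⊥-elim (All.lookup x∉ (∈-lookup j) eq)
lookup-injective (x∉ ∷ _)  (fs i) fz     eq = ⊥-elim (All.lookup x∉ (∈-lookup i) (sym eq))
lookup-injective (_ ∷ uni) (fs i) (fs j) eq = cong fs (lookup-injective uni i j eq)

sum-indicator : ∀ {X : Set} (p : X → Bool) xs →
                sum (map (λ x → if p x then 1 else 0) xs) ≡ length (filter (λ x → p x ≟ᵇ true) xs)
sum-indicator p []       = refl
sum-indicator p (x ∷ xs) with p x
... | true  = cong suc (sum-indicator p xs)
... | false = sum-indicator p xs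

∈⇒≤max : ∀ {x xs} → x ∈ xs → x ≤ foldr _⊔_ 0 xs
∈⇒≤max {xs = y ∷ ys} (here refl) = m≤m⊔n y _
∈⇒≤max {xs = y ∷ ys} (there x∈)  = ≤-trans (∈⇒≤max x∈) (m≤n⊔m y _)

max-attained : ∀ {d} xs → d < foldr _⊔_ 0 xs → Σ ℕ λ x → x ∈ xs × d < x
max-attained {d} (y ∷ ys) d< with d <? y
... | yes d<y = y , here refl , d<y
... | no  d≮y with max-attained ys (subst (d <_) (m≤n⇒m⊔n≡n {y} {foldr _⊔_ 0 ys} y≤) d<)
  where
  y≤ : y ≤ foldr _⊔_ 0 ys
  y≤ with ≤-total y (foldr _⊔_ 0 ys)
  ... | inj₁ le = le
  ... | inj₂ ge = ⊥-elim (d≮y (subst (d <_) (m≥n⇒m⊔n≡m ge) d<))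
...   | x , x∈ , d<x = x , there x∈ , d<x

toℕ-clamp : ∀ m ℓ → toℕ (clamp m ℓ) ≡ m ⊓ ℓ
toℕ-clamp zero    ℓ       = refl
toℕ-clamp (suc m) zero    = refl
toℕ-clamp (suc m) (suc ℓ) = cong suc (toℕ-clamp m ℓ)

toℕ-clamp-≤ : ∀ {m ℓ} → ℓ ≤ m → toℕ (clamp m ℓ) ≡ ℓ
toℕ-clamp-≤ {m} {ℓ} ℓ≤m = trans (toℕ-clamp m ℓ) (m≥n⇒m⊓n≡n ℓ≤m)

-- Degrees and independent sets

module Structure (A : GStr) (ar : Arithm A) where

  M : ℕ
  M = m ar

  ix : U A → Fin (suc M)
  ix u = proj₁ (ι-sur ar u)

  ι-ix : ∀ u → ι ar (ix u) ≡ u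
  ι-ix u = proj₂ (ι-sur ar u)

  ix-ι : ∀ a → ix (ι ar a) ≡ a
  ix-ι a = ι-inj ar _ _ (ι-ix (ι ar a))

  ix-injective : ∀ {u v} → ix u ≡ ix v → u ≡ v
  ix-injective {u} {v} eq = trans (sym (ι-ix u)) (trans (cong (ι ar) eq) (ι-ix v))

  val : U A → ℕ
  val u = toℕ (ix u)

  el : ℕ → U A
  el = constInterp A ar

  val-injective : ∀ {u v} → val u ≡ val v → u ≡ v
  val-injective = ix-injective ∘ toℕ-injective

  val≤ : ∀ u → val u ≤ M
  val≤ u = s≤s⁻¹ (toℕ<n (ix u))

  val-el : ∀ {ℓ} → ℓ ≤ M → val (el ℓ) ≡ ℓ
  val-el ℓ≤M = trans (cong toℕ (ix-ι _)) (toℕ-clamp-≤ ℓ≤M)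

  el-val : ∀ u → el (val u) ≡ u
  el-val u = val-injective (val-el (val≤ u))

  ≡ᵇ-true : ∀ {b : Bool} {i j} → b ≡ (i ≡ᵇ j) → (b ≡ true → i ≡ j) × (i ≡ j → b ≡ true)
  ≡ᵇ-true {i = i} {j} refl =
    (λ e → ≡ᵇ⇒≡ i j (Equivalence.from T-≡ e)) , (λ e → Equivalence.to T-≡ (≡⇒≡ᵇ i j e))

  Add-val : ∀ u v w → (Add A u v w ≡ true → val u + val v ≡ val w) ×
                    (val u + val v ≡ val w → Add A u v w ≡ true)
  Add-val u v w = ≡ᵇ-true (subst₂
    (λ u′ v′ → Add A u′ v′ w ≡ (val u + val v ≡ᵇ val w)) (ι-ix u) (ι-ix v)
    (subst (λ w′ → Add A _ _ w′ ≡ (val u + val v ≡ᵇ val w)) (ι-ix w) (ι-add ar (ix u) (ix v) (ix w))))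

  Mul-val : ∀ u v w → (Mul A u v w ≡ true → val u * val v ≡ val w) ×
                    (val u * val v ≡ val w → Mul A u v w ≡ true)
  Mul-val u v w = ≡ᵇ-true (subst₂
    (λ u′ v′ → Mul A u′ v′ w ≡ (val u * val v ≡ᵇ val w)) (ι-ix u) (ι-ix v)
    (subst (λ w′ → Mul A _ _ w′ ≡ (val u * val v ≡ᵇ val w)) (ι-ix w) (ι-mul ar (ix u) (ix v) (ix w))))

  HasNbrs : ℕ → U A → Set
  HasNbrs s u = Σ (Fin s → U A) λ g → (∀ i j → g i ≡ g j → i ≡ j) × (∀ i → E A u (g i) ≡ true)

  nbrs : U A → List (Fin (suc M))
  nbrs u = filter (λ i → E A u (ι ar i) ≟ᵇ true) (allFin (suc M))

  vdeg≡length : ∀ u → vdeg A ar u ≡ length (nbrs u)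
  vdeg≡length u = sum-indicator (λ i → E A u (ι ar i)) (allFin (suc M))

  ∈-nbrs : ∀ {u v} → E A u v ≡ true → ix v ∈ nbrs u
  ∈-nbrs {u} {v} Euv = ∈-filter⁺ (λ i → E A u (ι ar i) ≟ᵇ true) (∈-allFin (ix v))
    (trans (cong (E A u) (ι-ix v)) Euv)

  HasNbrs⇒≤vdeg : ∀ {s u} → HasNbrs s u → s ≤ vdeg A ar u
  HasNbrs⇒≤vdeg {s} {u} (g , g-inj , Eg) = subst (s ≤_) (sym (vdeg≡length u))
    (injection-into-list (nbrs u) (ix ∘ g) (λ i j → g-inj i j ∘ ix-injective) (∈-nbrs ∘ Eg))

  ≤vdeg⇒HasNbrs : ∀ {s u} → s ≤ vdeg A ar u → HasNbrs s u
  ≤vdeg⇒HasNbrs {s} {u} s≤ = ι ar ∘ nbr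
    , (λ i j eq → inject≤-injective s≤′ s≤′ i j (lookup-injective unique _ _ (ι-inj ar _ _ eq)))
    , (λ i → proj₂ (∈-filter⁻ (λ i → E A u (ι ar i) ≟ᵇ true)
        {xs = allFin (suc M)} (∈-lookup (inject≤ i s≤′))))
    where
    s≤′ : s ≤ length (nbrs u)
    s≤′ = subst (s ≤_) (vdeg≡length u) s≤
    nbr : Fin s → Fin (suc M)
    nbr i = lookup (nbrs u) (inject≤ i s≤′)
    unique : Unique (nbrs u)
    unique = filter⁺ (λ i → E A u (ι ar i) ≟ᵇ true) (allFin⁺ (suc M))

  vdeg≤maxDeg : ∀ u → vdeg A ar u ≤ maxDeg A ar
  vdeg≤maxDeg u = subst (λ v → vdeg A ar v ≤ maxDeg A ar) (ι-ix u)
    (∈⇒≤max (∈-map⁺ (λ i → vdeg A ar (ι ar i)) (∈-allFin (ix u))))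

  HasNbrs⇒≤maxDeg : ∀ {s u} → HasNbrs s u → s ≤ maxDeg A ar
  HasNbrs⇒≤maxDeg {u = u} has = ≤-trans (HasNbrs⇒≤vdeg has) (vdeg≤maxDeg u)

  <maxDeg⇒HasNbrs : ∀ {d} → d < maxDeg A ar → Σ (U A) (HasNbrs (suc d))
  <maxDeg⇒HasNbrs d< with max-attained (map (λ i → vdeg A ar (ι ar i)) (allFin (suc M))) d<
  ... | x , x∈ , d<x with ∈-map⁻ (λ i → vdeg A ar (ι ar i)) x∈
  ...   | i , _ , refl = ι ar i , ≤vdeg⇒HasNbrs d<x

  HasIndepSet-mono : ∀ {s t} → s ≤ t → HasIndepSet A t → HasIndepSet A s
  HasIndepSet-mono s≤t (g , g-inj , indep) =
      (λ i → g (inject≤ i s≤t))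
    , (λ i j eq → inject≤-injective s≤t s≤t i j (g-inj _ _ eq))
    , (λ i j → indep _ _)

  -- The closed neighbourhoods of the chosen vertices, listed with repetitions.
  blocked : ∀ {s} → (Fin s → U A) → List (Fin (suc M))
  blocked {zero}  g = []
  blocked {suc s} g = ix (g fz) ∷ nbrs (g fz) ++ blocked (g ∘ fs)

  ∈-blocked-self : ∀ {s} (g : Fin s → U A) i → ix (g i) ∈ blocked g
  ∈-blocked-self g fz     = here refl
  ∈-blocked-self g (fs i) = there (∈-++⁺ʳ (nbrs (g fz)) (∈-blocked-self (g ∘ fs) i))

  ∈-blocked-nbr : ∀ {s} (g : Fin s → U A) i {v} → E A (g i) v ≡ true → ix v ∈ blocked g
  ∈-blocked-nbr g fz     Ev = there (∈-++⁺ˡ (∈-nbrs Ev))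
  ∈-blocked-nbr g (fs i) Ev = there (∈-++⁺ʳ (nbrs (g fz)) (∈-blocked-nbr (g ∘ fs) i Ev))

  length-blocked : ∀ {k s} (g : Fin s → U A) → maxDeg A ar ≤ k → length (blocked g) ≤ s * suc k
  length-blocked {s = zero}  g deg≤k = z≤n
  length-blocked {k} {suc s} g deg≤k = s≤s (≤-trans (≤-reflexive (length-++ (nbrs (g fz))))
    (+-mono-≤ (≤-trans (≤-reflexive (sym (vdeg≡length (g fz)))) (≤-trans (vdeg≤maxDeg (g fz)) deg≤k))
              (length-blocked (g ∘ fs) deg≤k)))

  open DecMembership (_≟ᶠ_ {suc M}) using (_∈?_)

  -- Otherwise the identity would inject all `suc M` vertices into a list of length at most `M`.
  unblocked : ∀ (xs : List (Fin (suc M))) → length xs ≤ M → Σ (Fin (suc M)) λ v → ¬ v ∈ xs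
  unblocked xs len≤M with any? (λ v → ¬? (v ∈? xs))
  ... | yes found = found
  ... | no  none  = ⊥-elim (<-irrefl refl (≤-trans
        (injection-into-list xs (λ v → v) (λ _ _ eq → eq)
          (λ v → decidable-stable (v ∈? xs) (λ v∉ → none (v , v∉)))) len≤M))

  -- Before each choice fewer than `k` vertices are chosen. They block at most `k * suc k`, hence at
  -- most `M`, of the `suc M` vertices, so one is left.
  greedy : ∀ {k} → IsGraph A → maxDeg A ar ≤ k → k * suc k ≤ M → ∀ s → s ≤ k → HasIndepSet A s
  greedy graph deg≤k large zero _ = (λ ()) , (λ ()) , (λ ())
  greedy {k} (irrefl , symm) deg≤k large (suc s) s<k
    with greedy (irrefl , symm) deg≤k large s (<⇒≤ s<k)
  ... | g , g-inj , indep
    with unblocked (blocked g)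
           (≤-trans (length-blocked g deg≤k) (≤-trans (*-monoˡ-≤ (suc k) (<⇒≤ s<k)) large))
  ...   | a , a∉ = extend v g , inj , ind
    where
    v = ι ar a
    v∉ : ¬ ix v ∈ blocked g
    v∉ = a∉ ∘ subst (_∈ blocked g) (ix-ι a)
    fresh : ∀ i → v ≢ g i
    fresh i eq = v∉ (subst (λ z → ix z ∈ blocked g) (sym eq) (∈-blocked-self g i))
    nonadj : ∀ i → E A (g i) v ≡ false
    nonadj i = ¬-not (v∉ ∘ ∈-blocked-nbr g i)
    inj : ∀ i j → extend v g i ≡ extend v g j → i ≡ j
    inj fz     fz     eq = refl
    inj fz     (fs j) eq = ⊥-elim (fresh j eq)
    inj (fs i) fz     eq = ⊥-elim (fresh i (sym eq))
    inj (fs i) (fs j) eq = cong fs (g-inj i j eq)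
    ind : ∀ i j → E A (extend v g i) (extend v g j) ≡ false
    ind fz     fz     = irrefl v
    ind fz     (fs j) = trans (symm v (g j)) (nonadj j)
    ind (fs i) fz     = nonadj i
    ind (fs i) (fs j) = indep i j

-- First-order definitions

module _ {H v : ℕ} where

  -- Truth is expressed by an equation between a constant and itself, so at least one constant must
  -- exist.
  ⊤′ ⊥′ : Formula (suc H) v
  ⊤′ = cst fz ≐ cst fz
  ⊥′ = ¬' ⊤′

  ⋁ ⋀ : ∀ {n} → (Fin n → Formula (suc H) v) → Formula (suc H) v
  ⋁ {zero}  φ = ⊥′
  ⋁ {suc n} φ = φ fz ∨' ⋁ (φ ∘ fs)
  ⋀ {zero}  φ = ⊤′
  ⋀ {suc n} φ = φ fz ∧' ⋀ (φ ∘ fs)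

  -- The condition is decided while the formula is built, so comparing indices costs no quantifier.
  unless : ∀ {P : Set} → Dec P → Formula (suc H) v → Formula (suc H) v
  unless (yes _) φ = ⊤′
  unless (no _)  φ = φ

  qr-⋁ : ∀ {n q} (φ : Fin n → Formula (suc H) v) → (∀ i → qr (φ i) ≤ q) → qr (⋁ φ) ≤ q
  qr-⋁ {zero}  φ φ≤q = z≤n
  qr-⋁ {suc n} φ φ≤q = ⊔-lub (φ≤q fz) (qr-⋁ (φ ∘ fs) (φ≤q ∘ fs))

  qr-⋀ : ∀ {n q} (φ : Fin n → Formula (suc H) v) → (∀ i → qr (φ i) ≤ q) → qr (⋀ φ) ≤ q
  qr-⋀ {zero}  φ φ≤q = z≤n
  qr-⋀ {suc n} φ φ≤q = ⊔-lub (φ≤q fz) (qr-⋀ (φ ∘ fs) (φ≤q ∘ fs))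

  qr-unless : ∀ {P : Set} {q} (P? : Dec P) (φ : Formula (suc H) v) → qr φ ≤ q → qr (unless P? φ) ≤ q
  qr-unless (yes _) φ φ≤q = z≤n
  qr-unless (no _)  φ φ≤q = φ≤q

  numeral : ℕ → Term (suc H) v
  numeral ℓ = cst (clamp H ℓ)

  differ : ∀ {s} → (Fin s → Fin (suc H)) → Fin s → Fin s → Formula (suc H) v
  differ g i j = unless (i ≟ᶠ j) (¬' (cst (g i) ≐ cst (g j)))

  distinct : ∀ {s} → (Fin s → Fin (suc H)) → Formula (suc H) v
  distinct g = ⋀ λ i → ⋀ λ j → differ g i j

  -- A finite disjunction over all `s`-tuples of constants takes the place of `s` quantifiers, so
  -- the rank does not grow with `s`; `finToFun` decodes the tuples.
  someConstants : ∀ s → ((Fin s → Fin (suc H)) → Formula (suc H) v) → Formula (suc H) v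
  someConstants s φ = ⋁ λ (e : Fin (suc H ^ s)) → let g = finToFun {suc H} {s} e in distinct g ∧' φ g

  qr-someConstants : ∀ {s q} (φ : (Fin s → Fin (suc H)) → Formula (suc H) v) →
                     (∀ g → qr (φ g) ≤ q) → qr (someConstants s φ) ≤ q
  qr-someConstants {s} φ φ≤q = qr-⋁ _ λ e → let g = finToFun {suc H} {s} e in ⊔-lub
    (qr-⋀ _ λ i → qr-⋀ (differ g i) λ j → qr-unless (i ≟ᶠ j) _ z≤n)
    (φ≤q g)

  nonAdjacent : ∀ {s} → (Fin s → Fin (suc H)) → Fin s → Fin s → Formula (suc H) v
  nonAdjacent g i j = ¬' E' (cst (g i)) (cst (g j))

  independent : ∀ {s} → (Fin s → Fin (suc H)) → Formula (suc H) v
  independent g = ⋀ λ i → ⋀ λ j → nonAdjacent g i j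

  namedIndep : ℕ → Formula (suc H) v
  namedIndep s = someConstants s independent

  qr-namedIndep : ∀ s → qr (namedIndep s) ≤ 0
  qr-namedIndep s = qr-someConstants {s = s} independent λ g →
    qr-⋀ (λ i → ⋀ (nonAdjacent g i)) λ i → qr-⋀ (nonAdjacent g i) λ j → z≤n

module _ {H : ℕ} where

  adjacent : ∀ {s} → (Fin s → Fin (suc H)) → Fin s → Formula (suc H) 1
  adjacent g i = E' (var fz) (cst (g i))

  namedNbrs : ℕ → Formula (suc H) 1
  namedNbrs s = someConstants s (⋀ ∘ adjacent)

  qr-namedNbrs : ∀ s → qr (namedNbrs s) ≤ 0
  qr-namedNbrs s = qr-someConstants {s = s} (⋀ ∘ adjacent) λ g → qr-⋀ (adjacent g) λ i → z≤n

  pattern #0 = fz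
  pattern #1 = fs fz
  pattern #2 = fs (fs fz)
  pattern #3 = fs (fs (fs fz))
  pattern #4 = fs (fs (fs (fs fz)))
  pattern #5 = fs (fs (fs (fs (fs fz))))
  pattern #6 = fs (fs (fs (fs (fs (fs fz)))))

  -- In the context x, b, w, u (de Bruijn indices 0 to 3): x ≡ w modulo 1 + c b.
  -- The quantified variables are c b, the modulus, the quotient and the difference of x and w.
  congruent : ℕ → Formula (suc H) 4
  congruent c = ∃' ∃' ∃' ∃' (
    Mul' (numeral c) (var #5) (var #3) ∧'
    (Add' (numeral 1) (var #3) (var #2) ∧'
    (Mul' (var #2) (var #1) (var #0) ∧'
    (Add' (var #4) (var #0) (var #6) ∨' Add' (var #6) (var #0) (var #4)))))

  module _ (d : ℕ) (o : Fin (Separation.N d)) (j : Fin (suc d)) where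
    open Separation d using (s; index)

    notCongruent : Fin s → Formula (suc H) 4
    notCongruent i = unless (i ≟ᶠ j) (¬' congruent (index o i))

    onlyNbr : Formula (suc H) 3
    onlyNbr = ∃' (E' (var #3) (var #0) ∧' (congruent (index o j) ∧' ⋀ notCongruent))

  hashedNbrs : (d : ℕ) → Formula (suc H) 1
  hashedNbrs d = ∃' ∃' ⋁ λ o → ⋀ λ j → onlyNbr d o j

  -- Two quantifiers for `w` and `b`, one for the neighbour, four inside `congruent`. Window and
  -- modulus are chosen by finite connectives, since their numbers depend only on `d`.
  qr-hashedNbrs : ∀ d → qr (hashedNbrs d) ≤ 7
  qr-hashedNbrs d = s≤s (s≤s (qr-⋁ _ λ o → qr-⋀ (onlyNbr d o) λ j → s≤s (⊔-lub ≤-refl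
    (qr-⋀ (notCongruent d o j) λ i → qr-unless (i ≟ᶠ j) _ ≤-refl))))

  isGraph : Formula (suc H) 0
  isGraph = ∀' ∀' ((¬' E' (var #0) (var #0)) ∧' ((¬' E' (var #0) (var #1)) ∨' E' (var #1) (var #0)))

-- The first summand makes room for separating `suc k` neighbours, the second for the greedy choice
-- of up to `k` vertices.
threshold : ℕ → ℕ
threshold k = Separation.θ k + k * suc k

module _ (k : ℕ) where
  private
    t H : ℕ
    t = threshold k
    H = suc t

  -- Each disjunct implies a vertex of degree above `k` in every structure; the first detects it in
  -- small structures, the second in large ones.
  manyNbrs : Sentence (suc H)
  manyNbrs = ∃' (namedNbrs (suc k) ∨' hashedNbrs k)

  -- Consecutive numerals denote the same element exactly when both are clamped to the last one,
  -- that is, when `M ≤ t`.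
  isLarge : Sentence (suc H)
  isLarge = ¬' (numeral t ≐ numeral H)

  -- The maximum degree is not known in advance, so each candidate `d` gets a clause; the one at the
  -- actual maximum degree is decisive.
  degreeOrIndep : Fin (suc k) → Sentence (suc H)
  degreeOrIndep d = (∃' namedNbrs (suc (toℕ d))) ∨' namedIndep (k ∸ toℕ d)

  definition : Sentence (suc H)
  definition = isGraph ∧' ((¬' manyNbrs) ∧' (isLarge ∨' ⋀ degreeOrIndep))

  qr-definition : qr definition ≤ 13
  qr-definition = ⊔-lub (s≤s (s≤s z≤n)) (⊔-lub
    (s≤s (⊔-lub (≤-trans (qr-namedNbrs (suc k)) z≤n) (≤-trans (qr-hashedNbrs k) (m≤m+n 7 5))))
    (qr-⋀ degreeOrIndep λ d →
      ⊔-lub (s≤s (≤-trans (qr-namedNbrs (suc (toℕ d))) z≤n)) (≤-trans (qr-namedIndep (k ∸ toℕ d)) z≤n)))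

-- Meaning of the formulas in a structure

module Semantics (A : GStr) (ar : Arithm A) (H : ℕ) where
  open Structure A ar

  infix 3 _⊨_
  _⊨_ : ∀ {v} → (Fin v → U A) → Formula (suc H) v → Set
  ρ ⊨ φ = Sat A ar ρ φ

  ⟦_⟧ : Fin (suc H) → U A
  ⟦ c ⟧ = el (toℕ c)

  val-numeral : ∀ {ℓ} → ℓ ≤ H → ℓ ≤ M → val ⟦ clamp H ℓ ⟧ ≡ ℓ
  val-numeral ℓ≤H ℓ≤M = trans (cong (val ∘ el) (toℕ-clamp-≤ ℓ≤H)) (val-el ℓ≤M)

  module _ {v : ℕ} {ρ : Fin v → U A} where

    sat-⋁⁻ : ∀ {n} (φ : Fin n → Formula (suc H) v) → ρ ⊨ ⋁ φ → Σ (Fin n) λ i → ρ ⊨ φ i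
    sat-⋁⁻ {zero}  φ sat = ⊥-elim (sat refl)
    sat-⋁⁻ {suc n} φ (inj₁ sat) = fz , sat
    sat-⋁⁻ {suc n} φ (inj₂ sat) with sat-⋁⁻ (φ ∘ fs) sat
    ... | i , sat′ = fs i , sat′

    sat-⋁⁺ : ∀ {n} (φ : Fin n → Formula (suc H) v) i → ρ ⊨ φ i → ρ ⊨ ⋁ φ
    sat-⋁⁺ φ fz     sat = inj₁ sat
    sat-⋁⁺ φ (fs i) sat = inj₂ (sat-⋁⁺ (φ ∘ fs) i sat)

    sat-⋀⁻ : ∀ {n} (φ : Fin n → Formula (suc H) v) → ρ ⊨ ⋀ φ → ∀ i → ρ ⊨ φ i
    sat-⋀⁻ φ (sat , _) fz     = sat
    sat-⋀⁻ φ (_ , sat) (fs i) = sat-⋀⁻ (φ ∘ fs) sat i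

    sat-⋀⁺ : ∀ {n} (φ : Fin n → Formula (suc H) v) → (∀ i → ρ ⊨ φ i) → ρ ⊨ ⋀ φ
    sat-⋀⁺ {zero}  φ sat = refl
    sat-⋀⁺ {suc n} φ sat = sat fz , sat-⋀⁺ (φ ∘ fs) (sat ∘ fs)

    sat-unless⁻ : ∀ {P : Set} (P? : Dec P) {φ : Formula (suc H) v} → ρ ⊨ unless P? φ → ¬ P → ρ ⊨ φ
    sat-unless⁻ (yes p) sat ¬p = ⊥-elim (¬p p)
    sat-unless⁻ (no _)  sat ¬p = sat

    sat-unless⁺ : ∀ {P : Set} (P? : Dec P) {φ : Formula (suc H) v} → (¬ P → ρ ⊨ φ) → ρ ⊨ unless P? φ
    sat-unless⁺ (yes p) sat = refl
    sat-unless⁺ (no ¬p) sat = sat ¬p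

    sat-someConstants⁻ : ∀ {s} (φ : (Fin s → Fin (suc H)) → Formula (suc H) v) → ρ ⊨ someConstants s φ →
                         Σ (Fin s → Fin (suc H)) λ g → (∀ i j → ⟦ g i ⟧ ≡ ⟦ g j ⟧ → i ≡ j) × (ρ ⊨ φ g)
    sat-someConstants⁻ {s} φ sat
      with sat-⋁⁻ (λ e → let g = finToFun {suc H} {s} e in distinct g ∧' φ g) sat
    ... | e , dist , satφ = g , inj , satφ
      where
      g : Fin s → Fin (suc H)
      g = finToFun e
      inj : ∀ i j → ⟦ g i ⟧ ≡ ⟦ g j ⟧ → i ≡ j
      inj i j eq = decidable-stable (i ≟ᶠ j) λ i≢j →
        sat-unless⁻ (i ≟ᶠ j) (sat-⋀⁻ (differ g i) (sat-⋀⁻ (λ i → ⋀ (differ g i)) dist i) j) i≢j eq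

    -- With `M ≤ H` every element is named by its own value. Decoding the tuple recovers the names
    -- only pointwise, so `φ` is asked of every `g′` that names `g` pointwise.
    sat-someConstants⁺ : M ≤ H → ∀ {s} (φ : (Fin s → Fin (suc H)) → Formula (suc H) v) (g : Fin s → U A) →
                         (∀ i j → g i ≡ g j → i ≡ j) → (∀ g′ → (∀ i → ⟦ g′ i ⟧ ≡ g i) → ρ ⊨ φ g′) →
                         ρ ⊨ someConstants s φ
    sat-someConstants⁺ M≤H {s} φ g g-inj sat = sat-⋁⁺ _ (funToFin name)
      ( sat-⋀⁺ _ (λ i → sat-⋀⁺ (differ (finToFun (funToFin name)) i) λ j → sat-unless⁺ (i ≟ᶠ j) λ i≢j eq →
          i≢j (g-inj i j (trans (sym (named i)) (trans eq (named j)))))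
      , sat (finToFun (funToFin name)) named)
      where
      name : Fin s → Fin (suc H)
      name i = clamp H (val (g i))
      named : ∀ i → ⟦ finToFun (funToFin name) i ⟧ ≡ g i
      named i = trans (cong ⟦_⟧ (finToFun-funToFin name i))
        (trans (cong el (toℕ-clamp-≤ (≤-trans (val≤ (g i)) M≤H))) (el-val (g i)))

    namedIndep⁻ : ∀ s → ρ ⊨ namedIndep s → HasIndepSet A s
    namedIndep⁻ s sat with sat-someConstants⁻ independent sat
    ... | g , g-inj , indep = ⟦_⟧ ∘ g , g-inj , λ i j →
      ¬-not (sat-⋀⁻ (nonAdjacent g i) (sat-⋀⁻ (λ i → ⋀ (nonAdjacent g i)) indep i) j)

    namedIndep⁺ : M ≤ H → ∀ {s} → HasIndepSet A s → ρ ⊨ namedIndep s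
    namedIndep⁺ M≤H (g , g-inj , indep) = sat-someConstants⁺ M≤H independent g g-inj λ g′ eq →
      sat-⋀⁺ (λ i → ⋀ (nonAdjacent g′ i)) λ i → sat-⋀⁺ (nonAdjacent g′ i) λ j →
        not-¬ (trans (cong₂ (E A) (eq i) (eq j)) (indep i j))

  module _ {u : U A} {ρ : Fin 0 → U A} where

    namedNbrs⁻ : ∀ s → extend u ρ ⊨ namedNbrs s → HasNbrs s u
    namedNbrs⁻ s sat with sat-someConstants⁻ {s = s} (⋀ ∘ adjacent) sat
    ... | g , g-inj , adj = ⟦_⟧ ∘ g , g-inj , sat-⋀⁻ (adjacent g) adj

    namedNbrs⁺ : M ≤ H → ∀ {s} → HasNbrs s u → extend u ρ ⊨ namedNbrs s
    namedNbrs⁺ M≤H (g , g-inj , adj) = sat-someConstants⁺ M≤H (⋀ ∘ adjacent) g g-inj λ g′ eq →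
      sat-⋀⁺ (adjacent g′) λ i → trans (cong (E A u) (eq i)) (adj i)

    module _ {w b x : U A} {c : ℕ} (c≤H : c ≤ H) (1≤H : 1 ≤ H) (c≤M : c ≤ M) (1≤M : 1 ≤ M) where

      μ : ℕ
      μ = 1 + c * val b

      congruent⁻ : extend x (extend b (extend w (extend u ρ))) ⊨ congruent c → val x ≋ val w [mod μ ]
      congruent⁻ (t , m′ , q , y , cb≡t , 1+t≡m , mq≡y , sum≡) = multiple⇒≋ {q = val q} (sum≡′ sum≡)
        where
        μ≡ : val m′ ≡ μ
        μ≡ = trans (sym (proj₁ (Add-val _ _ _) 1+t≡m)) (cong₂ _+_ (val-numeral 1≤H 1≤M)
          (trans (sym (proj₁ (Mul-val _ _ _) cb≡t)) (cong (_* val b) (val-numeral c≤H c≤M))))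
        y≡ : val y ≡ μ * val q
        y≡ = trans (sym (proj₁ (Mul-val _ _ _) mq≡y)) (cong (_* val q) μ≡)
        sum≡′ : (Add A x y w ≡ true) ⊎ (Add A w y x ≡ true) →
                (val x + μ * val q ≡ val w) ⊎ (val w + μ * val q ≡ val x)
        sum≡′ (inj₁ e) = inj₁ (trans (cong (val x +_) (sym y≡)) (proj₁ (Add-val _ _ _) e))
        sum≡′ (inj₂ e) = inj₂ (trans (cong (val w +_) (sym y≡)) (proj₁ (Add-val _ _ _) e))

      -- All witnesses fit into the universe: `c * val b` is below `μ`, and `μ * q`, hence also `q`,
      -- is at most the larger of `val x` and `val w`.
      congruent⁺ : μ ≤ M → val x ≋ val w [mod μ ] → extend x (extend b (extend w (extend u ρ))) ⊨ congruent c
      congruent⁺ μ≤M x≋w with ≋⇒multiple x≋w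
      ... | q , eq = el (c * val b) , el μ , el q , el (μ * q)
        , proj₂ (Mul-val _ _ _) (trans (cong (_* val b) (val-numeral c≤H c≤M)) (sym (val-el (<⇒≤ μ≤M))))
        , proj₂ (Add-val _ _ _) (trans (cong₂ _+_ (val-numeral 1≤H 1≤M) (val-el (<⇒≤ μ≤M))) (sym (val-el μ≤M)))
        , proj₂ (Mul-val _ _ _) (trans (cong₂ _*_ (val-el μ≤M) (val-el q≤M)) (sym (val-el μq≤M)))
        , sum≡ eq
        where
        bound : (val x + μ * q ≡ val w) ⊎ (val w + μ * q ≡ val x) → μ * q ≤ M
        bound (inj₁ e) = ≤-trans (m≤n+m (μ * q) (val x)) (≤-trans (≤-reflexive e) (val≤ w))
        bound (inj₂ e) = ≤-trans (m≤n+m (μ * q) (val w)) (≤-trans (≤-reflexive e) (val≤ x))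
        μq≤M : μ * q ≤ M
        μq≤M = bound eq
        q≤M : q ≤ M
        q≤M = ≤-trans (m≤n*m q μ) μq≤M
        sum≡ : (val x + μ * q ≡ val w) ⊎ (val w + μ * q ≡ val x) →
               (Add A x (el (μ * q)) w ≡ true) ⊎ (Add A w (el (μ * q)) x ≡ true)
        sum≡ (inj₁ e) = inj₁ (proj₂ (Add-val _ _ _) (trans (cong (val x +_) (val-el μq≤M)) e))
        sum≡ (inj₂ e) = inj₂ (proj₂ (Add-val _ _ _) (trans (cong (val w +_) (val-el μq≤M)) e))

    -- Were two witnesses equal, one and the same formula `congruent` would be both asserted and
    -- denied of that element; its meaning does not enter.
    hashedNbrs⁻ : ∀ d → extend u ρ ⊨ hashedNbrs d → HasNbrs (suc d) u
    hashedNbrs⁻ d (w , b , sat) = witness , inj , λ j → proj₁ (proj₂ (nbr j))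
      where
      open Separation d using (s; N; index)
      ρ′ : Fin 3 → U A
      ρ′ = extend b (extend w (extend u ρ))
      chosen : Σ (Fin N) λ o → ρ′ ⊨ ⋀ (onlyNbr d o)
      chosen = sat-⋁⁻ (λ o → ⋀ (onlyNbr d o)) sat
      o : Fin N
      o = proj₁ chosen
      nbr : ∀ j → ρ′ ⊨ onlyNbr d o j
      nbr = sat-⋀⁻ (onlyNbr d o) (proj₂ chosen)
      witness : Fin s → U A
      witness j = proj₁ (nbr j)
      own : ∀ j → extend (witness j) ρ′ ⊨ congruent (index o j)
      own j = proj₁ (proj₂ (proj₂ (nbr j)))
      others : ∀ i j → i ≢ j → ¬ (extend (witness j) ρ′ ⊨ congruent (index o i))
      others i j = sat-unless⁻ (i ≟ᶠ j) (sat-⋀⁻ (notCongruent d o j) (proj₂ (proj₂ (proj₂ (nbr j)))) i)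
      inj : ∀ i j → witness i ≡ witness j → i ≡ j
      inj i j eq = decidable-stable (i ≟ᶠ j) λ i≢j →
        others i j i≢j (subst (λ x → extend x ρ′ ⊨ congruent (index o i)) eq (own i))

    hashedNbrs⁺ : ∀ d → Separation.θ d ≤ M → Separation.θ d ≤ H → HasNbrs (suc d) u → extend u ρ ⊨ hashedNbrs d
    hashedNbrs⁺ d θ≤M θ≤H (g , g-inj , adj) =
      let b , w , o , w≤M , μ≤M , w≋x , x≋̸x =
            separated θ≤M (val ∘ g) (λ i j → g-inj i j ∘ val-injective) (val≤ ∘ g)
      in hash b w o w≤M μ≤M w≋x x≋̸x
      where
      open Separation d using (s; L≤θ; C; θ; index; index≤L; modulus; separated)
      1≤θ : 1 ≤ θ
      1≤θ = m^n>0 (C * C) s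
      hash : ∀ b w o → w ≤ M → (∀ j → modulus b o j ≤ M) → (∀ j → w ≋ val (g j) [mod modulus b o j ]) →
             (∀ i j → i ≢ j → ¬ val (g i) ≋ val (g j) [mod modulus b o i ]) → extend u ρ ⊨ hashedNbrs d
      hash b w o w≤M μ≤M w≋x x≋̸x = el w , el b , sat-⋁⁺ (λ o → ⋀ (onlyNbr d o)) o (sat-⋀⁺ (onlyNbr d o) λ j →
        g j , adj j ,
        congruent⁺ (c≤ j θ≤H) (≤-trans 1≤θ θ≤H) (c≤ j θ≤M) (≤-trans 1≤θ θ≤M)
          (subst (λ z → 1 + index o j * z ≤ M) (sym b≡) (μ≤M j))
          (transport j (≋-sym (w≋x j))) ,
        -- If `g j` were congruent to `w` modulo the modulus of `i`, it would be congruent to `g i`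
        -- there, against separation.
        sat-⋀⁺ (notCongruent d o j) λ i → sat-unless⁺ (i ≟ᶠ j) λ i≢j sat →
          x≋̸x i j i≢j (≋-trans (≋-sym (w≋x i)) (≋-sym
          (untransport i (congruent⁻ (c≤ i θ≤H) (≤-trans 1≤θ θ≤H) (c≤ i θ≤M) (≤-trans 1≤θ θ≤M) sat)))))
        where
        c≤ : ∀ j {n} → θ ≤ n → index o j ≤ n
        c≤ j θ≤n = ≤-trans (index≤L o j) (≤-trans L≤θ θ≤n)
        -- Indices start at 1, so `b` is below each modulus.
        b≤M : b ≤ M
        b≤M = ≤-trans (m≤m+n b _) (<⇒≤ (μ≤M fz))
        b≡ : val (el b) ≡ b
        b≡ = val-el b≤M
        w≡ : val (el w) ≡ w
        w≡ = val-el w≤M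
        transport : ∀ i {z} → z ≋ w [mod modulus b o i ] → z ≋ val (el w) [mod modulus (val (el b)) o i ]
        transport i = subst₂ (λ w b → _ ≋ w [mod modulus b o i ]) (sym w≡) (sym b≡)
        untransport : ∀ i {z} → z ≋ val (el w) [mod modulus (val (el b)) o i ] → z ≋ w [mod modulus b o i ]
        untransport i = subst₂ (λ w b → _ ≋ w [mod modulus b o i ]) w≡ b≡

  isGraph⁻ : ∀ {ρ} → ρ ⊨ isGraph → IsGraph A
  isGraph⁻ sat = (λ u → ¬-not (proj₁ (sat u u))) , symm
    where
    implies : ∀ u w → E A u w ≡ true → E A w u ≡ true
    implies u w Euw with proj₂ (sat w u)
    ... | inj₁ ¬Euw = ⊥-elim (¬Euw Euw)
    ... | inj₂ Ewu  = Ewu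
    symm : ∀ u w → E A u w ≡ E A w u
    symm u w with E A u w in eq | E A w u in eq′
    ... | true  | true  = refl
    ... | false | false = refl
    ... | true  | false = trans (sym (implies u w eq)) eq′
    ... | false | true  = trans (sym eq) (implies w u eq′)

  isGraph⁺ : ∀ {ρ} → IsGraph A → ρ ⊨ isGraph
  isGraph⁺ (irrefl , symm) w u = not-¬ (irrefl u) , edge
    where
    edge : (E A u w ≡ true → ⊥) ⊎ (E A w u ≡ true)
    edge with E A u w in eq
    ... | true  = inj₂ (trans (symm w u) eq)
    ... | false = inj₁ λ ()

-- Correctness of the defining sentence

module Correctness (A : GStr) (ar : Arithm A) (k : ℕ) (ρ : Fin 0 → U A) where
  open Structure A ar
  t = threshold k
  H = suc t
  open Semantics A ar H

  θ≤t : Separation.θ k ≤ t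
  θ≤t = m≤m+n _ _

  isLarge⁻ : ρ ⊨ isLarge k → t < M
  isLarge⁻ sat = ≰⇒> λ M≤t → sat (cong (ι ar) (toℕ-injective (trans (clamped (n≤1+n t) M≤t)
    (sym (clamped ≤-refl (m≤n⇒m≤1+n M≤t))))))
    where
    clamped : ∀ {ℓ} → ℓ ≤ H → M ≤ ℓ → toℕ (clamp M (toℕ (clamp H ℓ))) ≡ M
    clamped ℓ≤H M≤ℓ = trans (cong (toℕ ∘ clamp M) (toℕ-clamp-≤ ℓ≤H)) (trans (toℕ-clamp M _) (m≤n⇒m⊓n≡m M≤ℓ))

  isLarge⁺ : t < M → ρ ⊨ isLarge k
  isLarge⁺ t<M eq = 1+n≢n (sym
    (trans (sym (val-numeral (n≤1+n t) (<⇒≤ t<M))) (trans (cong val eq) (val-numeral ≤-refl t<M))))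

  manyNbrs⁻ : ρ ⊨ manyNbrs k → k < maxDeg A ar
  manyNbrs⁻ (u , inj₁ sat) = HasNbrs⇒≤maxDeg (namedNbrs⁻ (suc k) sat)
  manyNbrs⁻ (u , inj₂ sat) = HasNbrs⇒≤maxDeg (hashedNbrs⁻ k sat)

  manyNbrs⁺ : k < maxDeg A ar → ρ ⊨ manyNbrs k
  manyNbrs⁺ k< with <maxDeg⇒HasNbrs k< | M ≤? t
  ... | u , has | yes M≤t = u , inj₁ (namedNbrs⁺ (m≤n⇒m≤1+n M≤t) has)
  ... | u , has | no  M≰t = u , inj₂ (hashedNbrs⁺ k (≤-trans θ≤t (<⇒≤ (≰⇒> M≰t))) (m≤n⇒m≤1+n θ≤t) has)

  sound : ρ ⊨ definition k → pDegIndSet A ar k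
  sound (graph , few , rest) = isGraph⁻ {ρ} graph , deg≤k , indep rest
    where
    D = maxDeg A ar
    deg≤k : D ≤ k
    deg≤k = ≮⇒≥ (few ∘ manyNbrs⁺)
    indep : ρ ⊨ (isLarge k ∨' ⋀ (degreeOrIndep k)) → HasIndepSet A (k ∸ D)
    indep (inj₁ large) = greedy (isGraph⁻ {ρ} graph) deg≤k
      (≤-trans (m≤n+m _ _) (<⇒≤ (isLarge⁻ large))) (k ∸ D) (m∸n≤m k D)
    -- As `D ≤ k`, clamping selects the clause for `D` itself. Its first alternative would provide a
    -- vertex with `D + 1` neighbours.
    indep (inj₂ small) with sat-⋀⁻ (degreeOrIndep k) small (clamp k D)
    ... | inj₁ (u , sat) = ⊥-elim (<-irrefl (toℕ-clamp-≤ deg≤k) (HasNbrs⇒≤maxDeg (namedNbrs⁻ _ sat)))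
    ... | inj₂ sat = subst (λ z → HasIndepSet A (k ∸ z)) (toℕ-clamp-≤ deg≤k) (namedIndep⁻ _ sat)

  complete : pDegIndSet A ar k → ρ ⊨ definition k
  complete (graph , deg≤k , indep) = isGraph⁺ {ρ} graph , (λ many → <⇒≱ (manyNbrs⁻ many) deg≤k) , rest
    where
    rest : ρ ⊨ (isLarge k ∨' ⋀ (degreeOrIndep k))
    rest with M ≤? t
    ... | no  M≰t = inj₁ (isLarge⁺ (≰⇒> M≰t))
    ... | yes M≤t = inj₂ (sat-⋀⁺ (degreeOrIndep k) cases)
      where
      M≤H = m≤n⇒m≤1+n M≤t
      cases : ∀ d → ρ ⊨ degreeOrIndep k d
      cases d with toℕ d <? maxDeg A ar
      ... | yes d< = let u , has = <maxDeg⇒HasNbrs d< in inj₁ (u , namedNbrs⁺ M≤H has)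
      -- Here `d` is at least the maximum degree, so the set required is no larger than the given
      -- one.
      ... | no  d≮ = inj₂ (namedIndep⁺ M≤H (HasIndepSet-mono (∸-monoʳ-≤ k (≮⇒≥ d≮)) indep))

theorem2p7 : SlicewiseDefinable 13 pDegIndSet
-- The constants run from 0 to `threshold k + 1`, the last one serving the comparison in `isLarge`.
theorem2p7 = (λ k → suc (suc (threshold k))) , (λ k → definition k , qr-definition k) , λ A ar k →
  Correctness.complete A ar k _ , Correctness.sound A ar k _
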